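{- Let $\mathcal{S}$ be the set of integer squares. (1) For any fixed square $a_0$ there are infinitely many Hilbert cubes $H(a_0;a_1,a_2)$ of dimension $d=2$ with this $a_0$ that are contained in $\mathcal{S}$. (2) For fixed $a_1$ there are only finitely many Hilbert cubes $H(a_0;a_1,\ldots,a_d)$ of dimension $d\ge 2$ with this $a_1$ that are contained in $\mathcal{S}$. The bound is effective: (a) for each $a_i$ ($1\le i\le d$) the upper bound $a_i\le \frac14(a_1-1)^2-a_0$ holds; (b) for each $a_i$ ($1\le i\le d$) there are at most $\tau(a_1)$ many choices.
   Context: $\mathcal{S}=\{n^2 : n\in\mathbb{N}\}$, where $\mathbb{N}$ denotes the non-negative integers. For integers $a_0,a_1,\ldots,a_d$ with $a_1,\ldots,a_d$ positive, the Hilbert cube of dimension $d$ is $H(a_0;a_1,\ldots,a_d)=\{a_0+\sum_{i=1}^d \varepsilon_i a_i : \varepsilon_i\in\{0,1\}\}$. For a positive integer $n$, $\tau(n)$ denotes the number of positive divisors of $n$.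
   Formalization: In (2)(b) the choices of a_i are counted for a given a_0 as well as the fixed a_1; with a_0 allowed to vary the bound fails (a_1 = 1155 has τ = 16, but a_2 takes at least 18 values). -}

module Defs where

open import Data.Fin using (Fin; toℕ)
open import Data.Integer using (ℤ; +_; 0ℤ; _+_; _*_; _<_)
open import Data.Integer.Properties using (+-0-monoid)
open import Data.List using (List; length; filter; map; upTo)
open import Data.List.Membership.Propositional using () renaming (_∈_ to _∈ˡ_)
open import Data.Nat as ℕ using (ℕ; suc)
open import Data.Nat.Divisibility using (_∣?_)
open import Data.Product using (∃; _×_)
open import Data.Vec using (Vec; lookup)
open import Data.Vec.Relation.Unary.All using (All)
open import Function.Definitions using (Injective)
open import Level using (0ℓ)
open import Relation.Binary.Core using (Rel)
open import Relation.Binary.PropositionalEquality using (_≡_)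
open import Relation.Unary using (Pred; _⊆_)

open import Algebra.Properties.Monoid.Sum +-0-monoid using (sum-syntax)

𝒮 : Pred ℤ 0ℓ
𝒮 x = ∃ λ (n : ℕ) → x ≡ + (n ℕ.^ 2)

-- The vector a lists (a₁ , … , a_d), so position i : Fin d holds a_{i+1}.
H : ∀ {d} → ℤ → Vec ℤ d → Pred ℤ 0ℓ
H {d} a₀ a x =
  ∃ λ (ε : Vec (Fin 2) d) → x ≡ a₀ + ∑[ i < d ] (+ toℕ (lookup ε i) * lookup a i)

-- Positivity of a₁, …, a_d is part of being a Hilbert cube; a₀ may be any
-- integer, and the aᵢ may coincide.
SquareCube : ∀ {d} → ℤ → Vec ℤ d → Set
SquareCube a₀ a = All (0ℤ <_) a × H a₀ a ⊆ 𝒮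

τ : ℕ → ℕ
τ n = length (filter (_∣? n) (map suc (upTo n)))

-- Infinitely many elements of P that are pairwise distinct with respect to ≈.
InfinitelyMany : {A : Set} → Rel A 0ℓ → Pred A 0ℓ → Set
InfinitelyMany {A} _≈_ P =
  ∃ λ (f : ℕ → A) → (∀ n → P (f n)) × Injective _≡_ _≈_ f

-- The list may repeat elements or contain elements outside P; neither
-- affects the upper bounds on the number of elements of P expressed here.
FinitelyMany : {A : Set} → Pred A 0ℓ → Set
FinitelyMany {A} P = ∃ λ (xs : List A) → ∀ x → P x → x ∈ˡ xs

AtMost : {A : Set} → ℕ → Pred A 0ℓ → Set
AtMost {A} n P = ∃ λ (xs : List A) → length xs ℕ.≤ n × (∀ x → P x → x ∈ˡ xs)

{-# OPTIONS --safe #-}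

-- If a₀ + s = x² and a₀ + a₁ + s = y², then a₁ = (y − x)(y + x) with y − x ≥ 1.
-- Hence 2x + 1 ≤ a₁, which bounds every subset sum s of a₂, …, a_d, and x is
-- determined by the divisor y − x of a₁.  Taking s to be the sum of all of
-- a₂, …, a_d, each at least 1, bounds the dimension as well.
-- The bound on a₁ itself needs a second side: take s = a₂ and a₀ + a₁ = v².
-- If v ≤ x, use the bound on x; otherwise x < v < y gives
-- a₁ = y² − x² ≥ (v + 1)² − v² = 2v + 1.
-- Infinitely many cubes with a given a₀ = m² arise from odd h > 1:
-- (m + h)² − m² is odd, hence equals (v + 1)² − v² for some v > m, and
-- a₁ = v² − m², a₂ = (m + h)² − m² work.
module Submission where

open import Defs
open import Data.Fin using (Fin; zero; suc; toℕ)
open import Data.Fin.Properties using (toℕ≤pred[n])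
open import Data.Integer as ℤ using (ℤ; 0ℤ; 1ℤ; ∣_∣; _-_; _^_; _<_; +_; +<+; +≤+)
import Data.Integer.Properties as ℤₚ
import Data.Integer.Tactic.RingSolver as ℤ-Solver
open import Data.List using (List; []; _∷_; filter; map; upTo; concatMap;
  cartesianProduct; cartesianProductWith)
open import Data.List.Membership.Propositional using () renaming (_∈_ to _∈ˡ_)
open import Data.List.Membership.Propositional.Properties
open import Data.List.Properties using (length-map)
open import Data.List.Relation.Unary.Any using (here)
open import Data.Nat as ℕ using (ℕ; zero; suc; z≤n; s≤s)
open import Data.Nat.Divisibility using (_∣_; _∣?_; ∣⇒≤; m∣m*n; 1∣_)
open import Data.Nat.DivMod using (m*n/n≡m)
import Data.Nat.Properties as ℕₚ
import Data.Nat.Tactic.RingSolver as ℕ-Solver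
open import Data.Product using (∃; ∃₂; _×_; _,_; proj₁; proj₂)
open import Data.Rational.Unnormalised as ℚᵘ using (_/_)
open import Data.Sum using (inj₁; inj₂)
open import Data.Vec using (Vec; []; _∷_; lookup; replicate; _[_]≔_)
open import Data.Vec.Relation.Unary.All as All using (All; []; _∷_)
import Data.Vec.Relation.Unary.All.Properties as Allₚ
open import Relation.Binary.PropositionalEquality
open import Relation.Unary using (_∈_; _≐_)

open import Algebra.Properties.Monoid.Sum ℤₚ.+-0-monoid using (sum-syntax)

-- Subset sums of the sides

subsetSum : ∀ {d} → Vec (Fin 2) d → Vec ℤ d → ℤ
subsetSum {d} ε a = ∑[ i < d ] (+ toℕ (lookup ε i) ℤ.* lookup a i)

none full : ∀ {d} → Vec (Fin 2) d
none = replicate _ zero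
full = replicate _ (suc zero)

only : ∀ {d} → Fin d → Vec (Fin 2) d
only i = none [ i ]≔ suc zero

subsetSum-none : ∀ {d} (a : Vec ℤ d) → subsetSum none a ≡ 0ℤ
subsetSum-none []      = refl
subsetSum-none (x ∷ a) = trans (ℤₚ.+-identityˡ _) (subsetSum-none a)

subsetSum-only : ∀ {d} (a : Vec ℤ d) i → subsetSum (only i) a ≡ lookup a i
subsetSum-only (x ∷ a) zero    = trans (cong₂ ℤ._+_ (ℤₚ.*-identityˡ x) (subsetSum-none a)) (ℤₚ.+-identityʳ x)
subsetSum-only (x ∷ a) (suc i) = trans (ℤₚ.+-identityˡ _) (subsetSum-only a i)

-- A positive integer is at least 1, so any bound on the full sum bounds the dimension.
subsetSum-full : ∀ {d} (a : Vec ℤ d) → All (0ℤ <_) a → + d ℤ.≤ subsetSum full a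
subsetSum-full []      []        = +≤+ z≤n
subsetSum-full (x ∷ a) (px ∷ pa) = ℤₚ.+-mono-≤
  (ℤₚ.≤-trans (ℤₚ.i<j⇒suc[i]≤j px) (ℤₚ.≤-reflexive (sym (ℤₚ.*-identityˡ x)))) (subsetSum-full a pa)

-- Gaps between squares

^2-mono-≤ : ∀ {m n} → m ℕ.≤ n → m ℕ.^ 2 ℕ.≤ n ℕ.^ 2
^2-mono-≤ = ℕₚ.^-monoˡ-≤ 2

^2-cancel-< : ∀ {m n} → m ℕ.^ 2 ℕ.< n ℕ.^ 2 → m ℕ.< n
^2-cancel-< m²<n² = ℕₚ.≰⇒> λ n≤m → ℕₚ.<⇒≱ m²<n² (^2-mono-≤ n≤m)

-- Chains (w + 1)² ≤ y² = x² + n ≤ w² + n. The free `w` allows bounding `x` itself or another root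
-- lying between `x` and `y`.
square-gap : ∀ {w x y n} → x ℕ.≤ w → w ℕ.< y → x ℕ.^ 2 ℕ.+ n ≡ y ℕ.^ 2 → suc (2 ℕ.* w) ℕ.≤ n
square-gap {w} {x} {y} {n} x≤w w<y eq = ℕₚ.+-cancelˡ-≤ (w ℕ.^ 2) _ _ (begin
  w ℕ.^ 2 ℕ.+ suc (2 ℕ.* w) ≡⟨ expand w ⟩
  suc w ℕ.^ 2               ≤⟨ ^2-mono-≤ w<y ⟩
  y ℕ.^ 2                   ≡⟨ eq ⟨
  x ℕ.^ 2 ℕ.+ n             ≤⟨ ℕₚ.+-monoˡ-≤ n (^2-mono-≤ x≤w) ⟩
  w ℕ.^ 2 ℕ.+ n             ∎)
  where
  open ℕₚ.≤-Reasoning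
  expand : ∀ w → w ℕ.* (w ℕ.* 1) ℕ.+ (1 ℕ.+ 2 ℕ.* w) ≡ (1 ℕ.+ w) ℕ.* ((1 ℕ.+ w) ℕ.* 1)
  expand = ℕ-Solver.solve-∀

root-< : ∀ x y {n} → x ℕ.^ 2 ℕ.+ suc n ≡ y ℕ.^ 2 → x ℕ.< y
root-< x y {n} eq = ^2-cancel-< (subst (x ℕ.^ 2 ℕ.<_) eq (ℕₚ.m<m+n (x ℕ.^ 2) (s≤s z≤n)))

root-bound : ∀ x y {n} → x ℕ.^ 2 ℕ.+ suc n ≡ y ℕ.^ 2 → suc (2 ℕ.* x) ℕ.≤ suc n
root-bound x y eq = square-gap {x} {x} {y} ℕₚ.≤-refl (root-< x y eq) eq

larger-root-bound : ∀ u v x y {n} → u ℕ.< x →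
  u ℕ.^ 2 ℕ.+ suc n ≡ v ℕ.^ 2 → x ℕ.^ 2 ℕ.+ suc n ≡ y ℕ.^ 2 → suc (2 ℕ.* v) ℕ.≤ suc n
larger-root-bound u v x y {n} u<x u²+n≡v² x²+n≡y² with ℕₚ.≤-total x v
... | inj₁ x≤v = square-gap {v} {x} {y} x≤v v<y x²+n≡y²
  where
  v<y : v ℕ.< y
  v<y = ^2-cancel-< (subst₂ ℕ._<_ u²+n≡v² x²+n≡y² (ℕₚ.+-monoˡ-< (suc n) (ℕₚ.^-monoˡ-< 2 u<x)))
... | inj₂ v≤x = ℕₚ.≤-trans (s≤s (ℕₚ.*-monoʳ-≤ 2 v≤x)) (root-bound x y x²+n≡y²)

-- Pairs of squares inside a cube

module _ {d} (a₀ : ℤ) n (as : Vec ℤ d) (cube : SquareCube a₀ (+ n ∷ as)) where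

  -- Switching the coefficient of a₁ from 0 to 1, with `ε` kept on the other sides, gives two
  -- vertices that differ by `n`.
  squares : (ε : Vec (Fin 2) d) → ∃₂ λ x y →
    a₀ ℤ.+ subsetSum ε as ≡ + (x ℕ.^ 2) × x ℕ.^ 2 ℕ.+ n ≡ y ℕ.^ 2
  squares ε with proj₂ cube (zero ∷ ε , refl) | proj₂ cube (suc zero ∷ ε , refl)
  ... | x , p | y , q = x , y , p′ ,
    ℤₚ.+-injective (trans (cong (ℤ._+ + n) (sym p′)) (trans (rearrange a₀ _ (+ n)) q))
    where
    p′ : a₀ ℤ.+ subsetSum ε as ≡ + (x ℕ.^ 2)
    p′ = trans (cong (λ s → a₀ ℤ.+ s) (sym (ℤₚ.+-identityˡ _))) p
    rearrange : ∀ a s b → a ℤ.+ s ℤ.+ b ≡ a ℤ.+ (1ℤ ℤ.* b ℤ.+ s)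
    rearrange = ℤ-Solver.solve-∀

  base-square : ∃₂ λ u v → a₀ ≡ + (u ℕ.^ 2) × u ℕ.^ 2 ℕ.+ n ≡ v ℕ.^ 2
  base-square with squares none
  ... | u , v , p , q =
    u , v , trans (sym (trans (cong (λ s → a₀ ℤ.+ s) (subsetSum-none as)) (ℤₚ.+-identityʳ a₀))) p , q

  edge-square : ∀ i → ∃₂ λ x y → a₀ ℤ.+ lookup as i ≡ + (x ℕ.^ 2) × x ℕ.^ 2 ℕ.+ n ≡ y ℕ.^ 2
  edge-square i with squares (only i)
  ... | x , y , p , q = x , y , trans (cong (λ s → a₀ ℤ.+ s) (sym (subsetSum-only as i))) p , q

-- The upper bound on each side

quarter-bound : ∀ (a₀ b : ℤ) x n → a₀ ℤ.+ b ≡ + (x ℕ.^ 2) → suc (2 ℕ.* x) ℕ.≤ suc n →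
  (b / 1) ℚᵘ.≤ (((+ suc n - 1ℤ) ^ 2) / 4) ℚᵘ.- (a₀ / 1)
-- Clearing the denominators 1 and 4 leaves an integer inequality. With a₁ = n + 1 it follows from
-- 2x ≤ a₁ - 1 by squaring.
quarter-bound a₀ b x n eq (s≤s 2x≤n) = ℚᵘ.*≤* (begin
  b ℤ.* + 4                                          ≡⟨ split a₀ b ⟩
  (+ 4 ℤ.* (a₀ ℤ.+ b)) ℤ.+ ℤ.- a₀ ℤ.* + 4            ≤⟨ ℤₚ.+-monoˡ-≤ (ℤ.- a₀ ℤ.* + 4) four ⟩
  (+ n) ^ 2 ℤ.+ ℤ.- a₀ ℤ.* + 4                       ≡⟨ unit (+ n) a₀ ⟩
  (((+ n) ^ 2) ℤ.* 1ℤ ℤ.+ ℤ.- a₀ ℤ.* + 4) ℤ.* 1ℤ     ∎)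
  where
  open ℤₚ.≤-Reasoning
  split : ∀ a b → b ℤ.* + 4 ≡ (+ 4 ℤ.* (a ℤ.+ b)) ℤ.+ ℤ.- a ℤ.* + 4
  split = ℤ-Solver.solve-∀
  unit : ∀ c a → c ^ 2 ℤ.+ ℤ.- a ℤ.* + 4 ≡ ((c ^ 2) ℤ.* 1ℤ ℤ.+ ℤ.- a ℤ.* + 4) ℤ.* 1ℤ
  unit c a = sym (trans (ℤₚ.*-identityʳ (c ^ 2 ℤ.* 1ℤ ℤ.+ ℤ.- a ℤ.* + 4)) (cong (ℤ._+ ℤ.- a ℤ.* + 4) (ℤₚ.*-identityʳ (c ^ 2))))
  four : + 4 ℤ.* (a₀ ℤ.+ b) ℤ.≤ (+ n) ^ 2
  four = begin
    + 4 ℤ.* (a₀ ℤ.+ b)       ≡⟨ cong (+ 4 ℤ.*_) eq ⟩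
    + 4 ℤ.* + (x ℕ.^ 2)      ≡⟨ ℤₚ.pos-* 4 (x ℕ.^ 2) ⟨
    + (4 ℕ.* x ℕ.^ 2)        ≡⟨ cong +_ (double x) ⟨
    + ((2 ℕ.* x) ℕ.^ 2)      ≤⟨ +≤+ (^2-mono-≤ 2x≤n) ⟩
    + (n ℕ.^ 2)              ≡⟨ pos-^2 n ⟩
    (+ n) ^ 2                ∎
    where
    double : ∀ x → 2 ℕ.* x ℕ.* (2 ℕ.* x ℕ.* 1) ≡ 4 ℕ.* (x ℕ.* (x ℕ.* 1))
    double = ℕ-Solver.solve-∀
    pos-^2 : ∀ n → + (n ℕ.^ 2) ≡ (+ n) ^ 2
    pos-^2 n = trans (ℤₚ.pos-* n (n ℕ.* 1)) (cong (+ n ℤ.*_) (ℤₚ.pos-* n 1))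

positive-< : ∀ (b : ℤ) u x → 0ℤ < b → + (u ℕ.^ 2) ℤ.+ b ≡ + (x ℕ.^ 2) → u ℕ.< x
positive-< (+ suc b) u x _ eq =
  ^2-cancel-< (subst (u ℕ.^ 2 ℕ.<_) (ℤₚ.+-injective eq) (ℕₚ.m<m+n _ (s≤s z≤n)))
positive-< (+ zero) _ _ (+<+ ())

side-bound : ∀ n k (a₀ : ℤ) (as : Vec ℤ (suc k)) → SquareCube a₀ (+ suc n ∷ as) →
  ∀ i → (lookup (+ suc n ∷ as) i / 1) ℚᵘ.≤ (((+ suc n - 1ℤ) ^ 2) / 4) ℚᵘ.- (a₀ / 1)
side-bound n k a₀ as@(a₂ ∷ _) cube@(_ ∷ 0<a₂ ∷ _ , _) zero
  with base-square a₀ (suc n) as cube | edge-square a₀ (suc n) as cube zero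
... | u , v , a₀≡u² , u²+n≡v² | x , y , p , q =
  -- Here a₀ + a₁ = v², so the larger root `v` must be bounded. Positivity of a₂ gives u < x, hence
  -- a second, higher pair of squares with difference a₁.
  quarter-bound a₀ (+ suc n) v n (trans (cong (ℤ._+ + suc n) a₀≡u²) (cong +_ u²+n≡v²))
    (larger-root-bound u v x y (positive-< a₂ u x 0<a₂ (trans (cong (ℤ._+ a₂) (sym a₀≡u²)) p)) u²+n≡v² q)
side-bound n k a₀ as cube (suc i) with edge-square a₀ (suc n) as cube i
... | x , y , p , q = quarter-bound a₀ (lookup as i) x n p (root-bound x y q)

-- Finiteness for fixed a₁

vectors : {A : Set} → List A → ∀ k → List (Vec A k)
vectors xs zero    = [] ∷ []
vectors xs (suc k) = cartesianProductWith _∷_ xs (vectors xs k)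

∈-vectors : ∀ {A : Set} {xs : List A} {k} (v : Vec A k) → (∀ i → lookup v i ∈ˡ xs) → v ∈ˡ vectors xs k
∈-vectors []      _ = here refl
∈-vectors (x ∷ v) p = ∈-cartesianProductWith⁺ _∷_ (p zero) (∈-vectors v λ i → p (suc i))

pos-∈ : ∀ {b : ℤ} {n} → 0ℤ < b → b < + n → b ∈ˡ map +_ (upTo n)
pos-∈ (+<+ _) (+<+ b<n) = ∈-map⁺ +_ (∈-upTo⁺ b<n)

module _ {d} (a₀ : ℤ) n (as : Vec ℤ d) (cube : SquareCube a₀ (+ suc n ∷ as)) where

  -- The root `x` of the vertex satisfies 2x + 1 ≤ n + 1, and a₀ is a square, hence nonnegative.
  -- This one bound controls each side and, through the full sum, the dimension.
  subsetSum-< : ∀ ε → subsetSum ε as < + (suc n ℕ.^ 2)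
  subsetSum-< ε with base-square a₀ (suc n) as cube | squares a₀ (suc n) as cube ε
  ... | u , _ , a₀≡u² , _ | x , y , p , q = begin-strict
    subsetSum ε as               ≤⟨ ℤₚ.i≤j+i _ (+ (u ℕ.^ 2)) ⟩
    + (u ℕ.^ 2) ℤ.+ subsetSum ε as ≡⟨ cong (ℤ._+ subsetSum ε as) a₀≡u² ⟨
    a₀ ℤ.+ subsetSum ε as        ≡⟨ p ⟩
    + (x ℕ.^ 2)                  <⟨ +<+ (ℕₚ.^-monoˡ-< 2 x<1+n) ⟩
    + (suc n ℕ.^ 2)              ∎
    where
    open ℤₚ.≤-Reasoning
    x<1+n : x ℕ.< suc n
    x<1+n = ℕₚ.≤-<-trans (ℕₚ.m≤m+n x (x ℕ.+ 0)) (root-bound x y q)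

  side-∈ : ∀ i → lookup as i ∈ˡ map +_ (upTo (suc n ℕ.^ 2))
  side-∈ i = pos-∈ (Allₚ.lookup⁺ (All.tail (proj₁ cube)) i)
    (subst (_< + (suc n ℕ.^ 2)) (subsetSum-only as i) (subsetSum-< (only i)))

  dimension-< : d ℕ.< suc n ℕ.^ 2
  dimension-< = ℤₚ.drop‿+<+ (ℤₚ.≤-<-trans (subsetSum-full as (All.tail (proj₁ cube))) (subsetSum-< full))

  base-∈ : a₀ ∈ˡ map (λ u → + (u ℕ.^ 2)) (upTo (suc n))
  base-∈ with base-square a₀ (suc n) as cube
  ... | u , v , a₀≡u² , q = subst (_∈ˡ map (λ u → + (u ℕ.^ 2)) (upTo (suc n))) (sym a₀≡u²)
    (∈-map⁺ (λ u → + (u ℕ.^ 2)) (∈-upTo⁺ (ℕₚ.≤-<-trans (ℕₚ.m≤m+n u (u ℕ.+ 0)) (root-bound u v q))))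

-- Dimension, base point and sides all lie in explicit finite ranges; the list enumerates the whole
-- box, whether or not an entry is a square cube.
cubes-finite : ∀ n → FinitelyMany {A = ∃ λ (k : ℕ) → ℤ × Vec ℤ (suc k)}
  (λ (k , a₀ , as) → SquareCube a₀ (+ suc n ∷ as))
cubes-finite n = concatMap cubes (upTo (suc n ℕ.^ 2)) , λ (k , a₀ , as) cube →
  ∈-concat⁺′ (∈-map⁺ (k ,_) (∈-cartesianProduct⁺ (base-∈ a₀ n as cube) (∈-vectors as (side-∈ a₀ n as cube))))
    (∈-map⁺ cubes (∈-upTo⁺ (ℕₚ.<-trans (ℕₚ.n<1+n k) (dimension-< a₀ n as cube))))
  where
  cubes : ℕ → List (∃ λ (k : ℕ) → ℤ × Vec ℤ (suc k))
  cubes k = map (k ,_) (cartesianProduct (map (λ u → + (u ℕ.^ 2)) (upTo (suc n)))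
                                         (vectors (map +_ (upTo (suc n ℕ.^ 2))) (suc k)))

-- Counting the choices for a side

-- The very list whose length defines `τ`, so the count holds by computation.
divisors : ℕ → List ℕ
divisors n = filter (_∣? n) (map suc (upTo n))

∈-divisors : ∀ {p n} → suc p ∣ suc n → suc p ∈ˡ divisors (suc n)
∈-divisors {n = n} p∣n = ∈-filter⁺ (_∣? suc n) (∈-map⁺ suc (∈-upTo⁺ (∣⇒≤ p∣n))) p∣n

-- Recovers x from n = p (2x + p); the value at p = 0 is junk.
root : ℕ → ℕ → ℕ
root n zero      = 0
root n p@(suc _) = (n ℕ./ p ℕ.∸ p) ℕ./ 2

root-correct : ∀ x y {n} → x ℕ.^ 2 ℕ.+ suc n ≡ y ℕ.^ 2 →
  ∃ λ p → p ∈ˡ divisors (suc n) × root (suc n) p ≡ x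
root-correct x y {n} eq with ℕₚ.m≤n⇒∃[o]m+o≡n (root-< x y eq)
... | q , refl = p , ∈-divisors (subst (p ∣_) (sym n≡) (m∣m*n (x ℕ.* 2 ℕ.+ p))) , (begin
  (suc n ℕ./ p ℕ.∸ p) ℕ./ 2                         ≡⟨ cong (λ m → (m ℕ./ p ℕ.∸ p) ℕ./ 2) n≡ ⟩
  (p ℕ.* (x ℕ.* 2 ℕ.+ p) ℕ./ p ℕ.∸ p) ℕ./ 2         ≡⟨ cong (λ m → (m ℕ.∸ p) ℕ./ 2)
    (trans (cong (ℕ._/ p) (ℕₚ.*-comm p (x ℕ.* 2 ℕ.+ p))) (m*n/n≡m (x ℕ.* 2 ℕ.+ p) p)) ⟩
  (x ℕ.* 2 ℕ.+ p ℕ.∸ p) ℕ./ 2                       ≡⟨ cong (ℕ._/ 2) (ℕₚ.m+n∸n≡m (x ℕ.* 2) p) ⟩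
  x ℕ.* 2 ℕ./ 2                                     ≡⟨ m*n/n≡m x 2 ⟩
  x                                                 ∎)
  where
  open ≡-Reasoning
  -- Since y = x + 1 + q, this is y - x; its successor form lets `root` and the division compute.
  p = suc q
  expand : ∀ x q → (1 ℕ.+ (x ℕ.+ q)) ℕ.* ((1 ℕ.+ (x ℕ.+ q)) ℕ.* 1) ≡
    x ℕ.* (x ℕ.* 1) ℕ.+ (1 ℕ.+ q) ℕ.* (x ℕ.* 2 ℕ.+ (1 ℕ.+ q))
  expand = ℕ-Solver.solve-∀
  n≡ : suc n ≡ p ℕ.* (x ℕ.* 2 ℕ.+ p)
  n≡ = ℕₚ.+-cancelˡ-≡ (x ℕ.^ 2) _ _ (trans eq (expand x q))

side-choices : ∀ n k (a₀ : ℤ) i → AtMost (τ (suc n))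
  (λ x → ∃ λ (as : Vec ℤ (suc k)) → SquareCube a₀ (+ suc n ∷ as) × x ≡ lookup (+ suc n ∷ as) i)
side-choices n k a₀ zero =
  -- The only value is a₁, and τ(a₁) is at least 1 because 1 divides a₁.
  + suc n ∷ [] , ∈-length (∈-divisors (1∣ suc n)) , λ { _ (_ , _ , refl) → here refl }
side-choices n k a₀ (suc i) =
  map side (divisors (suc n)) , ℕₚ.≤-reflexive (length-map side (divisors (suc n))) , complete
  where
  side : ℕ → ℤ
  -- From a₀ + aᵢ = x², the side is determined once a divisor of a₁ fixes x.
  side p = + (root (suc n) p ℕ.^ 2) - a₀
  cancel : ∀ a b → a ℤ.+ b - a ≡ b
  cancel = ℤ-Solver.solve-∀
  complete : ∀ x → (∃ λ (as : Vec ℤ (suc k)) → SquareCube a₀ (+ suc n ∷ as) × x ≡ lookup as i) →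
    x ∈ˡ map side (divisors (suc n))
  complete _ (as , cube , refl) with edge-square a₀ (suc n) as cube i
  ... | x , y , r , s with root-correct x y s
  ... | p , p∈ , refl =
    subst (_∈ˡ map side (divisors (suc n))) (trans (cong (_- a₀) (sym r)) (cancel a₀ _)) (∈-map⁺ side p∈)

-- Infinitely many two-dimensional cubes

-- The trailing zeros match what `vertex` reduces to when exactly one coefficient is 1.
increment-square : ∀ m e →
  m ℕ.* (m ℕ.* 1) ℕ.+ (e ℕ.* (2 ℕ.* m ℕ.+ e) ℕ.+ 0 ℕ.+ 0) ≡ (m ℕ.+ e) ℕ.* ((m ℕ.+ e) ℕ.* 1)
increment-square = ℕ-Solver.solve-∀

module _ (m : ℕ) where

  increment : ℕ → ℕ
  increment e = e ℕ.* (2 ℕ.* m ℕ.+ e)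

  increment-pos : ∀ e → 0ℤ < + increment (suc e)
  increment-pos e = +<+ (ℕₚ.*-mono-≤ (s≤s (z≤n {e})) (ℕₚ.≤-trans (s≤s z≤n) (ℕₚ.m≤n+m (suc e) (2 ℕ.* m))))

  -- With h = 2t + 3, this r satisfies (m + h)² − m² = 2 (m + 1 + r) + 1.
  h r : ℕ → ℕ
  h t = suc (suc (suc (2 ℕ.* t)))
  r t = 3 ℕ.+ 6 ℕ.* t ℕ.+ 2 ℕ.* t ℕ.* t ℕ.+ 2 ℕ.* m ℕ.+ 2 ℕ.* m ℕ.* t

  sides : ℕ → Vec ℤ 2
  sides t = + increment (suc (r t)) ∷ + increment (h t) ∷ []

  vertex : ℕ → Fin 2 → Fin 2 → ℕ
  vertex t e₁ e₂ = m ℕ.^ 2 ℕ.+ (toℕ e₁ ℕ.* increment (suc (r t)) ℕ.+ (toℕ e₂ ℕ.* increment (h t) ℕ.+ 0))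

  vertex≡ : ∀ t e₁ e₂ → + (m ℕ.^ 2) ℤ.+ subsetSum (e₁ ∷ e₂ ∷ []) (sides t) ≡ + vertex t e₁ e₂
  vertex≡ t e₁ e₂ = sym (cong₂ (λ a b → + (m ℕ.^ 2) ℤ.+ (a ℤ.+ (b ℤ.+ 0ℤ)))
    (ℤₚ.pos-* (toℕ e₁) _) (ℤₚ.pos-* (toℕ e₂) _))

  -- With v = m + 1 + r, the second side equals (v + 1)² - v², so it carries v² to the next square.
  vertex-root : ℕ → Fin 2 → Fin 2 → ℕ
  vertex-root t zero       zero       = m
  vertex-root t (suc zero) zero       = m ℕ.+ suc (r t)
  vertex-root t zero       (suc zero) = m ℕ.+ h t
  vertex-root t (suc zero) (suc zero) = suc (m ℕ.+ suc (r t))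

  vertex-square : ∀ t e₁ e₂ → vertex t e₁ e₂ ≡ vertex-root t e₁ e₂ ℕ.^ 2
  vertex-square t zero zero = ℕₚ.+-identityʳ _
  vertex-square t (suc zero) zero = increment-square m (suc (r t))
  vertex-square t zero (suc zero) = increment-square m (h t)
  vertex-square t (suc zero) (suc zero) = eq m t
    where
    eq : ∀ m t →
      let r = 4 ℕ.+ 6 ℕ.* t ℕ.+ 2 ℕ.* t ℕ.* t ℕ.+ 2 ℕ.* m ℕ.+ 2 ℕ.* m ℕ.* t
          h = 3 ℕ.+ 2 ℕ.* t
          v = 1 ℕ.+ (m ℕ.+ r)
      in m ℕ.* (m ℕ.* 1) ℕ.+ ((r ℕ.* (2 ℕ.* m ℕ.+ r) ℕ.+ 0) ℕ.+ ((h ℕ.* (2 ℕ.* m ℕ.+ h) ℕ.+ 0) ℕ.+ 0)) ≡ v ℕ.* (v ℕ.* 1)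
    eq = ℕ-Solver.solve-∀

  sides-squareCube : ∀ t → SquareCube (+ (m ℕ.^ 2)) (sides t)
  sides-squareCube t = increment-pos (r t) ∷ increment-pos (suc (suc (2 ℕ.* t))) ∷ [] ,
    λ { (e₁ ∷ e₂ ∷ [] , refl) → vertex-root t e₁ e₂ ,
        trans (vertex≡ t e₁ e₂) (cong +_ (vertex-square t e₁ e₂)) }

  top : ℕ → ℕ
  top t = vertex t (suc zero) (suc zero)

  vertex≤top : ∀ t e₁ e₂ → vertex t e₁ e₂ ℕ.≤ top t
  vertex≤top t e₁ e₂ = ℕₚ.+-monoʳ-≤ (m ℕ.^ 2) (ℕₚ.+-mono-≤
    (ℕₚ.*-monoˡ-≤ (increment (suc (r t))) (toℕ≤pred[n] e₁))
    (ℕₚ.+-monoˡ-≤ 0 (ℕₚ.*-monoˡ-≤ (increment (h t)) (toℕ≤pred[n] e₂))))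

  top-mono-< : ∀ {s t} → s ℕ.< t → top s ℕ.< top t
  top-mono-< {s} {t} s<t = subst₂ ℕ._<_ (sym (vertex-square s (suc zero) (suc zero))) (sym (vertex-square t (suc zero) (suc zero)))
    (ℕₚ.^-monoˡ-< 2 (s≤s (ℕₚ.+-monoʳ-< m (s≤s r-mono))))
    where
    s≤t = ℕₚ.<⇒≤ s<t
    r-mono : r s ℕ.< r t
    -- The summand 6t grows strictly whatever m is; weak monotonicity suffices for the rest.
    r-mono = ℕₚ.+-mono-<-≤ (ℕₚ.+-monoˡ-< (2 ℕ.* m) (ℕₚ.+-mono-<-≤ (ℕₚ.+-monoʳ-< 3 (ℕₚ.*-monoʳ-< 6 s<t))
      (ℕₚ.*-mono-≤ (ℕₚ.*-monoʳ-≤ 2 s≤t) s≤t))) (ℕₚ.*-monoʳ-≤ (2 ℕ.* m) s≤t)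

  -- Cubes are compared as point sets: the top vertex of one belongs to the other, hence is at most
  -- the maximum there. As `top` is strictly increasing, distinct parameters give distinct sets.
  H-top : ∀ {s t} → H (+ (m ℕ.^ 2)) (sides s) ≐ H (+ (m ℕ.^ 2)) (sides t) → top s ℕ.≤ top t
  H-top {s} {t} (⊆ , _) with ⊆ (suc zero ∷ suc zero ∷ [] , sym (vertex≡ s (suc zero) (suc zero)))
  ... | e₁ ∷ e₂ ∷ [] , eq =
    subst (ℕ._≤ top t) (sym (ℤₚ.+-injective (trans eq (vertex≡ t e₁ e₂)))) (vertex≤top t e₁ e₂)

  sides-injective : ∀ {s t} → H (+ (m ℕ.^ 2)) (sides s) ≐ H (+ (m ℕ.^ 2)) (sides t) → s ≡ t
  sides-injective eq@(⊆ , ⊇) = ℕₚ.≤-antisym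
    (ℕₚ.≮⇒≥ λ t<s → ℕₚ.<⇒≱ (top-mono-< t<s) (H-top eq))
    (ℕₚ.≮⇒≥ λ s<t → ℕₚ.<⇒≱ (top-mono-< s<t) (H-top (⊇ , ⊆)))

theorem1p4 : (∀ (a₀ : ℤ) → a₀ ∈ 𝒮 →
    InfinitelyMany {A = Vec ℤ 2} (λ a b → H a₀ a ≐ H a₀ b) (λ a → SquareCube a₀ a))
    ×
    (∀ (a₁ : ℤ) → 0ℤ < a₁ →
    FinitelyMany {A = ∃ λ (k : ℕ) → ℤ × Vec ℤ (suc k)}
    (λ (k , a₀ , as) → SquareCube a₀ (a₁ ∷ as))
    ×
    (∀ (k : ℕ) (a₀ : ℤ) (as : Vec ℤ (suc k)) → SquareCube a₀ (a₁ ∷ as) →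
    ∀ (i : Fin (suc (suc k))) →
    (lookup (a₁ ∷ as) i / 1) ℚᵘ.≤ (((a₁ - 1ℤ) ^ 2) / 4) ℚᵘ.- (a₀ / 1))
    ×
    (∀ (k : ℕ) (a₀ : ℤ) (i : Fin (suc (suc k))) →
    AtMost (τ ∣ a₁ ∣)
    (λ x → ∃ λ (as : Vec ℤ (suc k)) →
    SquareCube a₀ (a₁ ∷ as) × x ≡ lookup (a₁ ∷ as) i)))
theorem1p4 =
  (λ { _ (m , refl) → sides m , sides-squareCube m , sides-injective m }) ,
  λ { (+ suc n) _ → cubes-finite n , side-bound n , side-choices n
    ; (+ zero) (+<+ ()) }
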